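{- Let $\mathsf{vB}$ be the smallest normal unimodal logic containing $\Box\Diamond\top\rightarrow\Box(\Box(\Box p\rightarrow p)\rightarrow p)$, and let $\mathsf{ID}$ be the logic of the van Benthem frame (the set of all unimodal formulas valid over that general frame). Then every normal modal logic $\mathsf{L}$ with $\mathsf{vB}\subseteq\mathsf{L}\subseteq\mathsf{ID}$ is $\mathcal{V}$-incomplete.
   Context: A normal (uni)modal logic is a set of formulas of the propositional modal language (with $\Box$ and its dual $\Diamond$) containing all classical tautologies and $\Box(p\to q)\to(\Box p\to\Box q)$ and closed under modus ponens, uniform substitution and necessitation. A modal algebra is a Boolean algebra with a unary operation $\Diamond$ satisfying $\Diamond(x\vee y)=\Diamond x\vee\Diamond y$ and $\Diamond\bot=\bot$; $\Box x=\neg\Diamond\neg x$. A modal algebra validates a formula $\varphi$ if every assignment of elements to propositional variables, extended homomorphically to all formulas, sends $\varphi$ to $\top$. A $\mathcal{V}$-BAO (in the unimodal case) is a modal algebra that is completely additive: for every set $X$ of elements, if $\bigvee X$ exists, then $\bigvee\{\Diamond x\mid x\in X\}$ exists and equals $\Diamond\bigvee X$. A normal modal logic $\mathsf{L}$ is $\mathcal{V}$-complete if it is exactly the set of formulas validated by all members of some class of $\mathcal{V}$-BAOs (equivalently, for all $\varphi$: $\varphi\in\mathsf{L}$ iff every $\mathcal{V}$-BAO validating all of $\mathsf{L}$ validates $\varphi$); otherwise it is $\mathcal{V}$-incomplete. The van Benthem frame is the general frame $\langle W,R,\mathbb{W}\rangle$ with $W=\mathbb{N}\cup\{\infty,\infty+1\}$;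 $R=\{\langle\infty+1,\infty\rangle,\langle\infty,\infty\rangle\}\cup\{\langle\infty,n\rangle\mid n\in\mathbb{N}\}\cup\{\langle m,n\rangle\mid m,n\in\mathbb{N},m>n\}$; and $\mathbb{W}=\{X\subseteq W\mid X\text{ is finite and }\infty\notin X\}\cup\{X\subseteq W\mid X\text{ is cofinite and }\infty\in X\}$. A formula is valid over a general frame $\langle W,R,\mathbb{W}\rangle$ if it is true at every point (in the usual Kripke semantics) under every valuation assigning elements of $\mathbb{W}$ to propositional variables. -}

module Defs where

open import Algebra.Core using (Op₁)
open import Algebra.Lattice.Bundles using (BooleanAlgebra)
import Algebra.Lattice.Properties.BooleanAlgebra as BooleanAlgebraProperties
open import Data.Bool.Base using (Bool; true; false; not) renaming (_∨_ to _or_)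
open import Data.Empty using (⊥)
open import Data.List.Base using (List)
open import Data.List.Membership.Propositional using (_∈_; _∉_)
open import Data.Nat.Base using (ℕ; _>_)
open import Data.Product.Base using (_×_; Σ-syntax; ∃-syntax)
open import Data.Sum.Base using (_⊎_)
open import Function.Bundles using (_⇔_)
open import Level using (Level; _⊔_; 0ℓ) renaming (suc to lsuc)
open import Relation.Binary.Bundles using (Poset)
open import Relation.Binary.Core using (Rel)
open import Relation.Binary.PropositionalEquality.Core using (_≡_)
open import Relation.Nullary.Negation.Core using (¬_)
open import Relation.Unary using (Pred; _⊆_; _≐_)

private
  variable
    a c ℓ : Level

infixr 5 _⇒_
infix 9 □_ ◇_

data Formula : Set where
  var : ℕ → Formula
  ⊥′  : Formula
  _⇒_ : Formula → Formula → Formula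
  □_  : Formula → Formula

⊤′ : Formula
⊤′ = ⊥′ ⇒ ⊥′

◇_ : Formula → Formula
◇ φ = (□ (φ ⇒ ⊥′)) ⇒ ⊥′

_[_] : Formula → (ℕ → Formula) → Formula
var p   [ σ ] = σ p
⊥′      [ σ ] = ⊥′
(φ ⇒ ψ) [ σ ] = (φ [ σ ]) ⇒ (ψ [ σ ])
(□ φ)   [ σ ] = □ (φ [ σ ])

-- Boxed formulas count as additional propositional atoms, with truth values
-- given by b.
truthValue : (v : ℕ → Bool) (b : Formula → Bool) → Formula → Bool
truthValue v b (var p) = v p
truthValue v b ⊥′      = false
truthValue v b (φ ⇒ ψ) = not (truthValue v b φ) or truthValue v b ψ
truthValue v b (□ φ)   = b φ

Tautology : Pred Formula 0ℓ
Tautology φ = ∀ v b → truthValue v b φ ≡ true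

K-axiom : Formula
K-axiom = □ (var 0 ⇒ var 1) ⇒ □ (var 0) ⇒ □ (var 1)

record IsNormal (L : Pred Formula a) : Set a where
  field
    tautology     : ∀ {φ} → Tautology φ → L φ
    K             : L K-axiom
    modusPonens   : ∀ {φ ψ} → L (φ ⇒ ψ) → L φ → L ψ
    substitution  : ∀ {φ} (σ : ℕ → Formula) → L φ → L (φ [ σ ])
    necessitation : ∀ {φ} → L φ → L (□ φ)

vB-axiom : Formula
vB-axiom = □ ◇ ⊤′ ⇒ □ (□ (□ (var 0) ⇒ var 0) ⇒ var 0)

data vB : Pred Formula 0ℓ where
  axiom         : vB vB-axiom
  tautology     : ∀ {φ} → Tautology φ → vB φ
  K             : vB K-axiom
  modusPonens   : ∀ {φ ψ} → vB (φ ⇒ ψ) → vB φ → vB ψ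
  substitution  : ∀ {φ} (σ : ℕ → Formula) → vB φ → vB (φ [ σ ])
  necessitation : ∀ {φ} → vB φ → vB (□ φ)

vB-isNormal : IsNormal vB
vB-isNormal = record
  { tautology     = tautology
  ; K             = K
  ; modusPonens   = modusPonens
  ; substitution  = substitution
  ; necessitation = necessitation
  }

vB-smallest : {L : Pred Formula a} → IsNormal L → L vB-axiom → vB ⊆ L
vB-smallest {L = L} N ax = go
  where
  module N = IsNormal N
  go : vB ⊆ L
  go axiom              = ax
  go (tautology t)      = N.tautology t
  go K                  = N.K
  go (modusPonens d e)  = N.modusPonens (go d) (go e)
  go (substitution σ d) = N.substitution σ (go d)
  go (necessitation d)  = N.necessitation (go d)

record ModalAlgebra c ℓ : Set (lsuc (c ⊔ ℓ)) where
  field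
    booleanAlgebra : BooleanAlgebra c ℓ

  open BooleanAlgebra booleanAlgebra public
    renaming (¬_ to ∁_; ⊤ to 𝟏; ⊥ to 𝟎)

  field
    dia      : Op₁ Carrier
    dia-cong : ∀ {x y} → x ≈ y → dia x ≈ dia y
    dia-∨    : ∀ x y → dia (x ∨ y) ≈ dia x ∨ dia y
    dia-𝟎    : dia 𝟎 ≈ 𝟎

  open Poset (BooleanAlgebraProperties.poset booleanAlgebra) public
    using (_≤_)

  box : Op₁ Carrier
  box x = ∁ (dia (∁ x))

  ⟦_⟧ : Formula → (ℕ → Carrier) → Carrier
  ⟦ var p ⟧ θ = θ p
  ⟦ ⊥′ ⟧    θ = 𝟎
  ⟦ φ ⇒ ψ ⟧ θ = (∁ (⟦ φ ⟧ θ)) ∨ ⟦ ψ ⟧ θ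
  ⟦ □ φ ⟧   θ = box (⟦ φ ⟧ θ)

  Validates : Pred Formula (c ⊔ ℓ)
  Validates φ = ∀ θ → ⟦ φ ⟧ θ ≈ 𝟏

  IsJoin : Pred Carrier a → Pred Carrier (c ⊔ ℓ ⊔ a)
  IsJoin X s = X ⊆ (_≤ s) × (∀ u → X ⊆ (_≤ u) → s ≤ u)

  dia-image : Pred Carrier a → Pred Carrier (c ⊔ ℓ ⊔ a)
  dia-image X y = ∃[ x ] X x × y ≈ dia x

-- Subsets are taken at level c ⊔ ℓ, so that they are closed under saturation
-- with respect to _≈_ and under direct images.
CompletelyAdditive : ModalAlgebra c ℓ → Set (lsuc (c ⊔ ℓ))
CompletelyAdditive {c} {ℓ} A =
  (X : Pred Carrier (c ⊔ ℓ)) (s : Carrier) →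
  IsJoin X s → IsJoin (dia-image X) (dia s)
  where open ModalAlgebra A

record V-BAO c ℓ : Set (lsuc (c ⊔ ℓ)) where
  field
    modalAlgebra       : ModalAlgebra c ℓ
    completelyAdditive : CompletelyAdditive modalAlgebra

  open ModalAlgebra modalAlgebra public

V-Complete : Pred Formula a → (c ℓ k : Level) → Set (a ⊔ lsuc (c ⊔ ℓ ⊔ k))
V-Complete L c ℓ k =
  Σ[ 𝒦 ∈ Pred (V-BAO c ℓ) k ]
    (∀ φ → L φ ⇔ (∀ A → 𝒦 A → V-BAO.Validates A φ))

V-Incomplete : Pred Formula a → (c ℓ k : Level) → Set (a ⊔ lsuc (c ⊔ ℓ ⊔ k))
V-Incomplete L c ℓ k = ¬ V-Complete L c ℓ k

module _ {W : Set} (R : Rel W 0ℓ) where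

  Forces : (ℕ → Pred W 0ℓ) → W → Formula → Set
  Forces V w (var p) = V p w
  Forces V w ⊥′      = ⊥
  Forces V w (φ ⇒ ψ) = Forces V w φ → Forces V w ψ
  Forces V w (□ φ)   = ∀ u → R w u → Forces V u φ

  ValidOver : ∀ {ℓ} → Pred (Pred W 0ℓ) ℓ → Pred Formula (lsuc 0ℓ ⊔ ℓ)
  ValidOver 𝕎 φ = ∀ V → (∀ p → 𝕎 (V p)) → ∀ w → Forces V w φ

data World : Set where
  fin : ℕ → World
  ∞   : World
  ∞+1 : World

data _⟶_ : Rel World 0ℓ where
  ∞+1⟶∞   : ∞+1 ⟶ ∞
  ∞⟶∞     : ∞ ⟶ ∞
  ∞⟶fin   : ∀ n → ∞ ⟶ fin n
  fin⟶fin : ∀ {m n} → m > n → fin m ⟶ fin n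

Finite : Pred (Pred World 0ℓ) 0ℓ
Finite X = ∃[ xs ] X ≐ (_∈ xs)

Cofinite : Pred (Pred World 0ℓ) 0ℓ
Cofinite X = ∃[ xs ] X ≐ (_∉ xs)

-- Admissible sets are decidable and closed under the operations interpreting
-- ⊥′, _⇒_ and □_, so that Forces is decidable under admissible valuations and
-- agrees with the classical truth definition.
Admissible : Pred (Pred World 0ℓ) 0ℓ
Admissible X = (Finite X × ¬ X ∞) ⊎ (Cofinite X × X ∞)

ID : Pred Formula (lsuc 0ℓ)
ID = ValidOver _⟶_ Admissible

{-# OPTIONS --safe #-}
-- Every 𝒱-BAO validating the axiom of vB validates □◇⊤ → □⊥, which fails at
-- ∞+1 in the van Benthem frame.  Write x p for the negation of □(□p → p) → p.
-- The axiom says that ◇(x p) lies below the complement of □◇⊤, for every p.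
-- By complete additivity it suffices that the elements x p have join ⊤, for
-- then ◇⊤ is disjoint from □◇⊤.  If u is an upper bound, then x u ≤ u; as also
-- x u ≤ ¬u, this means □(□u → u) ≤ u.  Monotonicity now gives
-- □u ≤ □(□u → u) ≤ u, so □u → u is ⊤, whence ⊤ = □⊤ ≤ u.
module Submission where

open import Defs
import Algebra.Lattice.Properties.BooleanAlgebra as BooleanAlgebraProperties
open import Data.List.Base using ([])
open import Data.Product.Base using (_,_; proj₂; ∃-syntax)
open import Data.Sum.Base using (inj₁)
open import Function.Base using (id)
open import Function.Bundles using (module Equivalence)
open import Level using (Level; _⊔_)
import Relation.Binary.Lattice.Properties.JoinSemilattice as JoinSemilatticeProperties
import Relation.Binary.Reasoning.Setoid as SetoidReasoning
open import Relation.Binary.Bundles using (Poset)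
open import Relation.Binary.Lattice.Bundles using (Lattice)
open import Relation.Nullary.Negation.Core using (¬_)
open import Relation.Unary using (Pred; _⊆_; ∅)

private
  variable
    c ℓ : Level

separatingFormula : Formula
separatingFormula = □ ◇ ⊤′ ⇒ □ ⊥′

-- The only successor of `∞+1` is `∞`, which sees itself, so `□ ◇ ⊤′` holds at `∞+1` while `□ ⊥′`
-- fails.
separatingFormula∉ID : ¬ ID separatingFormula
separatingFormula∉ID valid =
  valid (λ _ → ∅) (λ _ → inj₁ (([] , (λ ()) , λ ()) , λ ())) ∞+1 □◇⊤ ∞ ∞+1⟶∞
  where
  □◇⊤ : Forces _⟶_ (λ _ → ∅) ∞+1 (□ ◇ ⊤′)
  □◇⊤ ∞ ∞+1⟶∞ □¬⊤ = □¬⊤ ∞ ∞⟶∞ id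

module ModalAlgebraProperties (A : ModalAlgebra c ℓ) where
  open ModalAlgebra A
  open BooleanAlgebraProperties booleanAlgebra
    using (poset; ∨-∧-orderTheoreticLattice; ∨-idem; ∨-identityˡ; ∨-zeroˡ;
           ∧-identityʳ; ¬⊥≈⊤; ¬⊤≈⊥; ¬-involutive)
  open Poset poset using (≤-respˡ-≈) renaming (trans to ≤-trans)
  open Lattice ∨-∧-orderTheoreticLattice using (y≤x∨y; joinSemilattice)
  open JoinSemilatticeProperties joinSemilattice using (x≤y⇒x∨y≈y)
  open SetoidReasoning setoid

  infixr 5 _⊃_
  _⊃_ : Carrier → Carrier → Carrier
  x ⊃ y = ∁ x ∨ y

  ∨≈⇒≤ : ∀ {x y} → x ∨ y ≈ y → x ≤ y
  ∨≈⇒≤ {x} {y} x∨y≈y = begin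
    x            ≈⟨ ∧-absorbs-∨ _ _ ⟨
    x ∧ (x ∨ y)  ≈⟨ ∧-congˡ x∨y≈y ⟩
    x ∧ y        ∎

  ≤⇒⊃≈𝟏 : ∀ {x y} → x ≤ y → x ⊃ y ≈ 𝟏
  ≤⇒⊃≈𝟏 {x} {y} x≤y = begin
    ∁ x ∨ y        ≈⟨ ∨-congˡ (x≤y⇒x∨y≈y x≤y) ⟨
    ∁ x ∨ (x ∨ y)  ≈⟨ ∨-assoc _ _ _ ⟨
    (∁ x ∨ x) ∨ y  ≈⟨ ∨-congʳ (∨-complementˡ x) ⟩
    𝟏 ∨ y          ≈⟨ ∨-zeroˡ y ⟩
    𝟏              ∎

  ⊃≈𝟏⇒≤ : ∀ {x y} → x ⊃ y ≈ 𝟏 → x ≤ y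
  ⊃≈𝟏⇒≤ {x} {y} x⊃y≈𝟏 = begin
    x                  ≈⟨ ∧-identityʳ x ⟨
    x ∧ 𝟏              ≈⟨ ∧-congˡ x⊃y≈𝟏 ⟨
    x ∧ (∁ x ∨ y)      ≈⟨ ∧-distribˡ-∨ _ _ _ ⟩
    x ∧ ∁ x ∨ x ∧ y    ≈⟨ ∨-congʳ (∧-complementʳ x) ⟩
    𝟎 ∨ x ∧ y          ≈⟨ ∨-identityˡ _ ⟩
    x ∧ y              ∎

  x≤𝟏 : ∀ {x} → x ≤ 𝟏
  x≤𝟏 {x} = sym (∧-identityʳ x)

  ∁≤⇒≈𝟏 : ∀ {x} → ∁ x ≤ x → x ≈ 𝟏
  ∁≤⇒≈𝟏 {x} ∁x≤x = begin
    x            ≈⟨ ∨-idem x ⟨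
    x ∨ x        ≈⟨ ∨-congʳ (¬-involutive x) ⟨
    ∁ x ⊃ x      ≈⟨ ≤⇒⊃≈𝟏 ∁x≤x ⟩
    𝟏            ∎

  ⊃∁-swap : ∀ {x y} → x ⊃ ∁ y ≈ 𝟏 → y ⊃ ∁ x ≈ 𝟏
  ⊃∁-swap = trans (∨-comm _ _)

  ∁-anti : ∀ {x y} → x ≤ y → ∁ y ≤ ∁ x
  ∁-anti {x} {y} x≤y = ⊃≈𝟏⇒≤ (⊃∁-swap (trans (∨-congˡ (¬-involutive y)) (≤⇒⊃≈𝟏 x≤y)))

  dia-mono : ∀ {x y} → x ≤ y → dia x ≤ dia y
  dia-mono x≤y = ∨≈⇒≤ (trans (sym (dia-∨ _ _)) (dia-cong (x≤y⇒x∨y≈y x≤y)))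

  box-mono : ∀ {x y} → x ≤ y → box x ≤ box y
  box-mono x≤y = ∁-anti (dia-mono (∁-anti x≤y))

  box-𝟏 : ∀ {x} → x ≈ 𝟏 → box x ≈ 𝟏
  box-𝟏 {x} x≈𝟏 = begin
    ∁ (dia (∁ x))  ≈⟨ ¬-cong (dia-cong (trans (¬-cong x≈𝟏) ¬⊤≈⊥)) ⟩
    ∁ (dia 𝟎)      ≈⟨ ¬-cong dia-𝟎 ⟩
    ∁ 𝟎            ≈⟨ ¬⊥≈⊤ ⟩
    𝟏              ∎

  löb : Carrier → Carrier
  löb p = box (box p ⊃ p) ⊃ p

  -- Membership up to `_≈_` puts this at level `c ⊔ ℓ`, the level over which `CompletelyAdditive`
  -- quantifies.
  löbFailure : Pred Carrier (c ⊔ ℓ)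
  löbFailure x = ∃[ p ] x ≈ ∁ (löb p)

  löbFailure-join : IsJoin löbFailure 𝟏
  löbFailure-join = (λ _ → x≤𝟏) , least
    where
    least : ∀ u → löbFailure ⊆ (_≤ u) → 𝟏 ≤ u
    least u bound = ≤-respˡ-≈ (box-𝟏 (≤⇒⊃≈𝟏 □u≤u)) □[□u⊃u]≤u
      where
      □[□u⊃u]≤u : box (box u ⊃ u) ≤ u
      -- At `p = u` the bound gives `∁ (löb u) ≤ u ≤ löb u`, and an element above its own complement
      -- is `𝟏`.
      □[□u⊃u]≤u = ⊃≈𝟏⇒≤ (∁≤⇒≈𝟏 (≤-trans (bound (u , refl)) (y≤x∨y _ u)))

      □u≤u : box u ≤ u
      □u≤u = ≤-trans (box-mono (y≤x∨y _ u)) □[□u⊃u]≤u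

  validates-separatingFormula :
    CompletelyAdditive A → Validates vB-axiom → Validates separatingFormula
  validates-separatingFormula additive valid θ = begin
    t ⊃ ∁ (dia (∁ 𝟎))  ≈⟨ ∨-congˡ (¬-cong (dia-cong ¬⊥≈⊤)) ⟩
    -- By contraposition this amounts to `dia 𝟏 ≤ ∁ t`, an instance of leastness of the join.
    t ⊃ ∁ (dia 𝟏)      ≈⟨ ⊃∁-swap (≤⇒⊃≈𝟏 (proj₂ diaJoin (∁ t) bound)) ⟩
    𝟏                  ∎
    where
    t : Carrier
    t = ⟦ □ ◇ ⊤′ ⟧ θ

    diaJoin : IsJoin (dia-image löbFailure) (dia 𝟏)
    diaJoin = additive löbFailure 𝟏 löbFailure-join

    bound : dia-image löbFailure ⊆ (_≤ ∁ t)
    bound (x , (p , x≈) , y≈) =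
      -- As `□ ◇ ⊤′` has no variables, the constant valuation `p` leaves `t` unchanged;
      -- `box (löb p)` unfolds to `∁ (dia (∁ (löb p)))`, so the axiom can be contraposed.
      ≤-respˡ-≈ (sym (trans y≈ (dia-cong x≈))) (⊃≈𝟏⇒≤ (⊃∁-swap (valid (λ _ → p))))

theorem5p2 : ∀ {a c ℓ k : Level} (L : Pred Formula a) → IsNormal L →
    vB ⊆ L → L ⊆ ID → V-Incomplete L c ℓ k
theorem5p2 L _ vB⊆L L⊆ID (𝒦 , complete) =
  -- Completeness is used twice: members of `𝒦` validate the axiom, and what they all validate lies
  -- in `L`.
  separatingFormula∉ID (L⊆ID (from (complete separatingFormula) λ A A∈𝒦 →
    ModalAlgebraProperties.validates-separatingFormula
      (V-BAO.modalAlgebra A) (V-BAO.completelyAdditive A)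
      (to (complete vB-axiom) (vB⊆L axiom) A A∈𝒦)))
  where open Equivalence
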